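{- If $G$ is a minimally dependent oriented hypergraph and $G'$ is a compatible subdivision of $G$, then $G'$ is minimally dependent.
   Context: An oriented hypergraph has disjoint finite sets of vertices and edges, incidences $(v,e,k)$ with $1\le k\le\iota(v,e)$, and an orientation $\sigma$ assigning $\pm1$ to each incidence. The incidence matrix has rows indexed by vertices, columns by edges, entries $\sum_k\sigma(v,e,k)$; minimally dependent means the columns are linearly dependent while every proper subfamily of columns is independent. An edge-subdivision of an edge $e$ partitions the incidences containing $e$ into two parts, replaces $e$ by two new edges $e_1,e_2$ (incidences of the first part now contain $e_1$, of the second $e_2$, orientations kept), and adds a new vertex $u$ with one incidence in $e_1$ and one in $e_2$; it is a compatible subdivision if $\sigma(u,e_1)\sigma(u,e_2)=-1$. -}

module Defs where

open import Data.Nat using (ℕ; suc)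
open import Data.Fin using (Fin; zero; suc; _≟_)
open import Data.Fin.Subset using (Subset; _∈_; _∉_)
open import Data.Bool using (Bool; true; false; if_then_else_)
open import Data.List using (List; _∷_; []; length; lookup; tabulate; map; foldr; allFin)
open import Data.Product using (_×_; _,_; Σ; ∃; ∃-syntax)
open import Data.Sign using (Sign) renaming (_*_ to _*ₛ_)
open import Data.Rational using (ℚ; 0ℚ; 1ℚ; -_; _+_; _*_)
open import Relation.Nullary using (¬_; yes; no)
open import Relation.Binary.PropositionalEquality using (_≡_; _≢_)

-- An oriented hypergraph with vertex set Fin n and edge set Fin m.
-- The incidences are given as a finite list of triples (v , e , σ):
-- each list entry is one incidence (v,e,k); the index k (1 ≤ k ≤ ι(v,e))
-- is the position of the entry among the entries with the same (v,e),
-- so ι(v,e) is the number of entries with vertex v and edge e.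
record OHG (n m : ℕ) : Set where
  constructor ohg
  field
    inc : List (Fin n × Fin m × Sign)
open OHG public

signℚ : Sign → ℚ
signℚ Sign.+ = 1ℚ
signℚ Sign.- = - 1ℚ

sumℚ : List ℚ → ℚ
sumℚ = foldr _+_ 0ℚ

-- Σ over Fin m
Σℚ : (m : ℕ) → (Fin m → ℚ) → ℚ
Σℚ m f = sumℚ (map f (allFin m))

-- contribution of one incidence to the matrix entry (v , e)
contrib : ∀ {n m} → Fin n → Fin m → Fin n × Fin m × Sign → ℚ
contrib v e (w , f , s) with v ≟ w | e ≟ f
... | yes _ | yes _ = signℚ s
... | _     | _     = 0ℚ

-- incidence matrix entry: Σ_k σ(v,e,k)
incMat : ∀ {n m} → OHG n m → Fin n → Fin m → ℚ
incMat G v e = sumℚ (map (contrib v e) (inc G))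

-- the columns indexed by the subset S are linearly dependent (over ℚ):
-- a linear combination supported on S, not all coefficients zero, vanishing.
DependentOn : ∀ {n m} → OHG n m → Subset m → Set
DependentOn {n} {m} G S =
  Σ (Fin m → ℚ) λ c →
    (∀ e → e ∉ S → c e ≡ 0ℚ) ×
    (∃[ e ] c e ≢ 0ℚ) ×
    (∀ v → Σℚ m (λ e → c e * incMat G v e) ≡ 0ℚ)

Full : (m : ℕ) → Subset m
Full m = Data.Vec.replicate m true
  where import Data.Vec

MinimallyDependent : ∀ {n m} → OHG n m → Set
MinimallyDependent {n} {m} G =
  DependentOn G (Full m) ×
  (∀ (S : Subset m) → (∃[ e ] e ∉ S) → ¬ DependentOn G S)

-- Edge-subdivision of edge e.
-- New vertex set Fin (suc n): the new vertex u is zero, old v is suc v.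
-- New edge set Fin (suc m): e₂ is zero, e₁ is suc e, an old edge f ≠ e is suc f.
-- part assigns to every incidence (list position) a part; only the
-- incidences containing e are affected: true ↦ e₁, false ↦ e₂.
-- s₁ = σ(u,e₁), s₂ = σ(u,e₂); u has exactly one incidence in e₁ and one in e₂.
relabel : ∀ {n m} → Fin m → Bool → Fin n × Fin m × Sign → Fin (suc n) × Fin (suc m) × Sign
relabel e b (v , f , s) with f ≟ e
... | yes _ = (suc v , (if b then suc e else zero) , s)
... | no _  = (suc v , suc f , s)

subdivide : ∀ {n m} → (G : OHG n m) → (e : Fin m) →
            (part : Fin (length (inc G)) → Bool) → (s₁ s₂ : Sign) →
            OHG (suc n) (suc m)
subdivide G e part s₁ s₂ = ohg
  ((zero , suc e , s₁) ∷ (zero , zero , s₂) ∷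
   tabulate (λ i → relabel e (part i) (lookup (inc G) i)))

Compatible : Sign → Sign → Set
Compatible s₁ s₂ = s₁ *ₛ s₂ ≡ Sign.-

module Submission where

-- In the subdivided hypergraph the new vertex u has a single nonzero row entry in each of e₁ and e₂,
-- so a column combination c vanishes on row u iff c(e₁)σ(u,e₁) + c(e₂)σ(u,e₂) = 0, which for a
-- compatible subdivision means c(e₁) = c(e₂). Under that condition every old row of the new matrix
-- equals the corresponding row of the old matrix, taken with the common value as coefficient of e.
-- Hence null combinations of the two matrices correspond, and a dependency on a proper edge subset
-- after subdividing restricts to one on a proper edge subset before.

open import Defs
open import Algebra.Bundles using (CommutativeRing)
open import Data.Bool using (Bool; true; false; if_then_else_)
open import Data.Empty using (⊥-elim)
open import Data.Fin using (Fin; zero; suc; _≟_; punchIn)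
open import Data.Fin.Properties using (suc-injective; punchInᵢ≢i)
open import Data.Fin.Subset using (_∉_; ∁; ⁅_⁆)
open import Data.Fin.Subset.Properties
  using (∈⊤; drop-there; drop-not-there; x∈⁅x⁆; x∈⁅y⁆⇒x≡y; x∈∁p⇒x∉p; x∉∁p⇒x∈p)
open import Data.List using (List; _∷_; []; length; lookup; tabulate; map)
open import Data.List.Properties using (map-tabulate)
open import Data.Nat using (ℕ)
open import Data.Product using (_×_; _,_; ∃-syntax)
open import Data.Rational using (ℚ; 0ℚ; 1ℚ; -_; _+_; _-_; _*_)
open import Data.Rational.Properties
  using (+-*-commutativeRing; +-0-group; *-zeroʳ; *-distribˡ-+; +-identityˡ; +-identityʳ)
open import Data.Rational.Solver using (module +-*-Solver)
open import Data.Sign using (Sign)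
open import Data.Vec using (_∷_)
open import Function using (_∘_; _⇔_; Equivalence; mk⇔)
open import Relation.Nullary using (¬_; Dec; yes; no)
open import Relation.Binary.PropositionalEquality
  using (_≡_; _≢_; refl; sym; trans; cong; cong₂; subst; module ≡-Reasoning)

open import Algebra.Properties.Semiring.Sum (CommutativeRing.semiring +-*-commutativeRing)
  using (sum; sum-cong-≗; sum-replicate-zero; sum-remove; ∑-distrib-+)
open import Algebra.Properties.Group +-0-group using (x∙y⁻¹≈ε⇒x≈y; x≈y⇒x∙y⁻¹≈ε)
open ≡-Reasoning

Σℚ≡sum : ∀ m (g : Fin m → ℚ) → Σℚ m g ≡ sum g
Σℚ≡sum ℕ.zero g = refl
Σℚ≡sum (ℕ.suc m) g = cong (g zero +_) (begin
  sumℚ (map g (tabulate suc))               ≡⟨ cong sumℚ (map-tabulate suc g) ⟩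
  sumℚ (tabulate (g ∘ suc))                 ≡⟨ cong sumℚ (sym (map-tabulate (λ i → i) (g ∘ suc))) ⟩
  Σℚ m (g ∘ suc)                            ≡⟨ Σℚ≡sum m (g ∘ suc) ⟩
  sum (g ∘ suc)                             ∎)

sum-zero : ∀ {m} {t : Fin m → ℚ} → (∀ i → t i ≡ 0ℚ) → sum t ≡ 0ℚ
sum-zero {m} t≗0 = trans (sum-cong-≗ t≗0) (sum-replicate-zero m)

sum-select : ∀ {m} (t : Fin m → ℚ) (i : Fin m) → (∀ j → j ≢ i → t j ≡ 0ℚ) → sum t ≡ t i
sum-select {ℕ.suc m} t i vanish = begin
  sum t                         ≡⟨ sum-remove t ⟩
  t i + sum (t ∘ punchIn i)     ≡⟨ cong (t i +_) (sum-zero (λ j → vanish _ (punchInᵢ≢i i j))) ⟩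
  t i + 0ℚ                      ≡⟨ +-identityʳ (t i) ⟩
  t i                           ∎

sumℚ-map-tabulate-zero : ∀ {A : Set} {l} (h : Fin l → A) {k : A → ℚ} →
  (∀ i → k (h i) ≡ 0ℚ) → sumℚ (map k (tabulate h)) ≡ 0ℚ
sumℚ-map-tabulate-zero {l = ℕ.zero} h vanish = refl
sumℚ-map-tabulate-zero {l = ℕ.suc l} h vanish =
  trans (cong₂ _+_ (vanish zero) (sumℚ-map-tabulate-zero (h ∘ suc) (vanish ∘ suc))) (+-identityˡ 0ℚ)

sumℚ-map-tabulate-lookup : ∀ {A B : Set} (L : List A) (h : Fin (length L) → B)
  {k : B → ℚ} {k′ : A → ℚ} → (∀ i → k (h i) ≡ k′ (lookup L i)) →
  sumℚ (map k (tabulate h)) ≡ sumℚ (map k′ L)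
sumℚ-map-tabulate-lookup [] h eq = refl
sumℚ-map-tabulate-lookup (x ∷ L) h eq =
  cong₂ _+_ (eq zero) (sumℚ-map-tabulate-lookup L (h ∘ suc) (eq ∘ suc))

contrib-diag : ∀ {n m} (v : Fin n) (f : Fin m) s → contrib v f (v , f , s) ≡ signℚ s
contrib-diag v f s with v ≟ v | f ≟ f
... | yes _ | yes _ = refl
... | no v≢v | _ = ⊥-elim (v≢v refl)
... | yes _ | no f≢f = ⊥-elim (f≢f refl)

contrib-vertex-≢ : ∀ {n m} {v w : Fin n} (f g : Fin m) s → v ≢ w →
  contrib v f (w , g , s) ≡ 0ℚ
contrib-vertex-≢ {v = v} {w} f g s v≢w with v ≟ w | f ≟ g
... | yes v≡w | _ = ⊥-elim (v≢w v≡w)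
... | no _ | yes _ = refl
... | no _ | no _ = refl

contrib-edge-≢ : ∀ {n m} (v w : Fin n) {f g : Fin m} s → f ≢ g →
  contrib v f (w , g , s) ≡ 0ℚ
contrib-edge-≢ v w {f} {g} s f≢g with v ≟ w | f ≟ g
... | _ | yes f≡g = ⊥-elim (f≢g f≡g)
... | yes _ | no _ = refl
... | no _ | no _ = refl

contrib-suc : ∀ {n m} (v w : Fin n) (f : Fin m) (g : Fin (ℕ.suc m)) s →
  contrib (suc v) g (suc w , g , s) ≡ contrib v f (w , f , s)
contrib-suc v w f g s = by-cases (v ≟ w)
  where
  by-cases : Dec (v ≡ w) → contrib (suc v) g (suc w , g , s) ≡ contrib v f (w , f , s)
  by-cases (yes refl) = trans (contrib-diag (suc v) g s) (sym (contrib-diag v f s))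
  by-cases (no v≢w) =
    trans (contrib-vertex-≢ g g s (v≢w ∘ suc-injective)) (sym (contrib-vertex-≢ f f s v≢w))

-- The share of incidence x in row v of the combination Σ_f c f · (column f).
weight : ∀ {n m} → (Fin m → ℚ) → Fin n → Fin n × Fin m × Sign → ℚ
weight c v (w , f , s) = c f * contrib v f (w , f , s)

weight-vertex-≢ : ∀ {n m} (c : Fin m → ℚ) (v w : Fin n) f s → v ≢ w →
  weight c v (w , f , s) ≡ 0ℚ
weight-vertex-≢ c v w f s v≢w = trans (cong (c f *_) (contrib-vertex-≢ f f s v≢w)) (*-zeroʳ (c f))

sum-weighted-contrib : ∀ {n m} (c : Fin m → ℚ) (v : Fin n) x →
  sum (λ f → c f * contrib v f x) ≡ weight c v x
sum-weighted-contrib c v (w , g , s) =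
  sum-select _ g (λ f f≢g → trans (cong (c f *_) (contrib-edge-≢ v w s f≢g)) (*-zeroʳ (c f)))

sum-weighted-contribs : ∀ {n m} (c : Fin m → ℚ) (v : Fin n) L →
  sum (λ f → c f * sumℚ (map (contrib v f) L)) ≡ sumℚ (map (weight c v) L)
sum-weighted-contribs c v [] = sum-zero (λ f → *-zeroʳ (c f))
sum-weighted-contribs c v (x ∷ L) = begin
  sum (λ f → c f * (contrib v f x + sumℚ (map (contrib v f) L)))
    ≡⟨ sum-cong-≗ (λ f → *-distribˡ-+ (c f) _ _) ⟩
  sum (λ f → c f * contrib v f x + c f * sumℚ (map (contrib v f) L))
    ≡⟨ ∑-distrib-+ (λ f → c f * contrib v f x) (λ f → c f * sumℚ (map (contrib v f) L)) ⟩
  sum (λ f → c f * contrib v f x) + sum (λ f → c f * sumℚ (map (contrib v f) L))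
    ≡⟨ cong₂ _+_ (sum-weighted-contrib c v x) (sum-weighted-contribs c v L) ⟩
  weight c v x + sumℚ (map (weight c v) L) ∎

combination-row : ∀ {n m} (G : OHG n m) (c : Fin m → ℚ) (v : Fin n) →
  Σℚ m (λ f → c f * incMat G v f) ≡ sumℚ (map (weight c v) (inc G))
combination-row {m = m} G c v = trans (Σℚ≡sum m _) (sum-weighted-contribs c v (inc G))

compatible-pair-sum≡0⇔ : ∀ {s₁ s₂} → Compatible s₁ s₂ → ∀ a b →
  (a * signℚ s₁ + (b * signℚ s₂ + 0ℚ) ≡ 0ℚ) ⇔ (a ≡ b)
compatible-pair-sum≡0⇔ {Sign.+} {Sign.-} _ a b = mk⇔
  (λ sum≡0 → x∙y⁻¹≈ε⇒x≈y a b (trans (sym (pair-sum≡difference a b)) sum≡0))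
  (λ a≡b → trans (pair-sum≡difference a b) (x≈y⇒x∙y⁻¹≈ε a≡b))
  where
  open +-*-Solver using (solve; _:=_; _:+_; _:*_; :-_; _:-_; con)
  pair-sum≡difference : ∀ a b → a * 1ℚ + (b * - 1ℚ + 0ℚ) ≡ a - b
  pair-sum≡difference = solve 2 (λ a b → a :* con 1ℚ :+ (b :* (:- con 1ℚ) :+ con 0ℚ) := a :- b) refl
compatible-pair-sum≡0⇔ {Sign.-} {Sign.+} _ a b = mk⇔
  (λ sum≡0 → sym (x∙y⁻¹≈ε⇒x≈y b a (trans (sym (pair-sum≡difference a b)) sum≡0)))
  (λ a≡b → trans (pair-sum≡difference a b) (x≈y⇒x∙y⁻¹≈ε (sym a≡b)))
  where
  open +-*-Solver using (solve; _:=_; _:+_; _:*_; :-_; _:-_; con)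
  pair-sum≡difference : ∀ a b → a * - 1ℚ + (b * 1ℚ + 0ℚ) ≡ b - a
  pair-sum≡difference = solve 2 (λ a b → a :* (:- con 1ℚ) :+ (b :* con 1ℚ :+ con 0ℚ) := b :- a) refl

IsNullCombination : ∀ {n m} → OHG n m → (Fin m → ℚ) → Set
IsNullCombination {m = m} G c = ∀ v → Σℚ m (λ f → c f * incMat G v f) ≡ 0ℚ

module Subdivision {n m} (G : OHG n m) (e : Fin m)
  (part : Fin (length (inc G)) → Bool) (s₁ s₂ : Sign) where

  G′ : OHG (ℕ.suc n) (ℕ.suc m)
  G′ = subdivide G e part s₁ s₂

  relabelled : Fin (length (inc G)) → Fin (ℕ.suc n) × Fin (ℕ.suc m) × Sign
  relabelled i = relabel e (part i) (lookup (inc G) i)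

  relabel-weight-new-vertex : ∀ (c : Fin (ℕ.suc m) → ℚ) b (x : Fin n × Fin m × Sign) →
    weight c zero (relabel e b x) ≡ 0ℚ
  relabel-weight-new-vertex c b (w , f , s) with f ≟ e
  ... | yes _ = weight-vertex-≢ c zero (suc w) (if b then suc e else zero) s (λ ())
  ... | no _ = weight-vertex-≢ c zero (suc w) (suc f) s (λ ())

  relabel-weight-old-vertex : ∀ (c : Fin (ℕ.suc m) → ℚ) → c zero ≡ c (suc e) →
    ∀ v b (x : Fin n × Fin m × Sign) → weight c (suc v) (relabel e b x) ≡ weight (c ∘ suc) v x
  relabel-weight-old-vertex c balanced v b (w , f , s) with f ≟ e
  ... | yes refl = cong₂ _*_ (coefficient b) (contrib-suc v w f (if b then suc e else zero) s)
    where
    coefficient : ∀ b → c (if b then suc e else zero) ≡ c (suc e)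
    coefficient true = refl
    coefficient false = balanced
  ... | no _ = cong (c (suc f) *_) (contrib-suc v w f (suc f) s)

  new-vertex-row : ∀ (c : Fin (ℕ.suc m) → ℚ) →
    Σℚ (ℕ.suc m) (λ f → c f * incMat G′ zero f) ≡ c (suc e) * signℚ s₁ + (c zero * signℚ s₂ + 0ℚ)
  new-vertex-row c = trans (combination-row G′ c zero)
    (cong₂ _+_ (cong (c (suc e) *_) (contrib-diag {ℕ.suc n} zero (suc e) s₁))
      (cong₂ _+_ (cong (c zero *_) (contrib-diag {ℕ.suc n} {ℕ.suc m} zero zero s₂))
        (sumℚ-map-tabulate-zero relabelled
          (λ i → relabel-weight-new-vertex c (part i) (lookup (inc G) i)))))

  old-vertex-row : ∀ (c : Fin (ℕ.suc m) → ℚ) → c zero ≡ c (suc e) → ∀ v →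
    Σℚ (ℕ.suc m) (λ f → c f * incMat G′ (suc v) f) ≡ Σℚ m (λ f → c (suc f) * incMat G v f)
  old-vertex-row c balanced v = begin
    Σℚ (ℕ.suc m) (λ f → c f * incMat G′ (suc v) f)
      ≡⟨ combination-row G′ c (suc v) ⟩
    weight c (suc v) (zero , suc e , s₁) + (weight c (suc v) (zero , zero , s₂) + R)
      ≡⟨ cong₂ _+_ (weight-vertex-≢ c (suc v) zero (suc e) s₁ (λ ()))
                   (cong (_+ R) (weight-vertex-≢ c (suc v) zero zero s₂ (λ ()))) ⟩
    0ℚ + (0ℚ + R)
      ≡⟨ trans (+-identityˡ _) (+-identityˡ R) ⟩
    R
      ≡⟨ sumℚ-map-tabulate-lookup (inc G) relabelled
           (λ i → relabel-weight-old-vertex c balanced v (part i) (lookup (inc G) i)) ⟩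
    sumℚ (map (weight (c ∘ suc) v) (inc G))
      ≡⟨ sym (combination-row G (c ∘ suc) v) ⟩
    Σℚ m (λ f → c (suc f) * incMat G v f) ∎
    where
    R = sumℚ (map (weight c (suc v)) (tabulate relabelled))

  splitCoefficients : (Fin m → ℚ) → Fin (ℕ.suc m) → ℚ
  splitCoefficients c zero = c e
  splitCoefficients c (suc f) = c f

  module _ (compatible : Compatible s₁ s₂) where

    new-vertex-row≡0⇔ : ∀ (c : Fin (ℕ.suc m) → ℚ) →
      (Σℚ (ℕ.suc m) (λ f → c f * incMat G′ zero f) ≡ 0ℚ) ⇔ (c (suc e) ≡ c zero)
    new-vertex-row≡0⇔ c = subst (λ x → (x ≡ 0ℚ) ⇔ (c (suc e) ≡ c zero)) (sym (new-vertex-row c))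
      (compatible-pair-sum≡0⇔ {s₁} {s₂} compatible (c (suc e)) (c zero))

    null-split : ∀ c → IsNullCombination G c → IsNullCombination G′ (splitCoefficients c)
    null-split c null zero = Equivalence.from (new-vertex-row≡0⇔ (splitCoefficients c)) refl
    null-split c null (suc v) = trans (old-vertex-row (splitCoefficients c) refl v) (null v)

    null-balanced : ∀ d → IsNullCombination G′ d → d zero ≡ d (suc e)
    null-balanced d null = sym (Equivalence.to (new-vertex-row≡0⇔ d) (null zero))

    null-restrict : ∀ d → IsNullCombination G′ d → IsNullCombination G (d ∘ suc)
    null-restrict d null v = trans (sym (old-vertex-row d (null-balanced d null) v)) (null (suc v))

    nonzero-restrict : ∀ d → IsNullCombination G′ d → ∃[ f ] d f ≢ 0ℚ → ∃[ f ] d (suc f) ≢ 0ℚ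
    nonzero-restrict d null (zero , d≢0) = e , d≢0 ∘ trans (null-balanced d null)
    nonzero-restrict d null (suc f , d≢0) = f , d≢0

    dependent-split : DependentOn G (Full m) → DependentOn G′ (Full (ℕ.suc m))
    dependent-split (c , _ , (f , c≢0) , null) =
      splitCoefficients c , (λ f f∉ → ⊥-elim (f∉ ∈⊤)) , (suc f , c≢0) , null-split c null

    -- A dependency of G′ yields one of G on the old edges; if it avoids e₂ it also avoids e,
    -- since the coefficients of e₁ and e₂ agree.
    dependent-restrict : ∀ {S} → DependentOn G′ S → ∃[ f ] f ∉ S →
      ∃[ T ] (∃[ f ] f ∉ T) × DependentOn G T
    dependent-restrict (d , outside , nonzero , null) (zero , e₂∉S) =
      ∁ ⁅ e ⁆ , (e , λ e∈∁ → x∈∁p⇒x∉p e∈∁ (x∈⁅x⁆ e)) ,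
      d ∘ suc , outside′ , nonzero-restrict d null nonzero , null-restrict d null
      where
      outside′ : ∀ g → g ∉ ∁ ⁅ e ⁆ → d (suc g) ≡ 0ℚ
      outside′ g g∉ = begin
        d (suc g) ≡⟨ cong (d ∘ suc) (x∈⁅y⁆⇒x≡y e (x∉∁p⇒x∈p g∉)) ⟩
        d (suc e) ≡⟨ sym (null-balanced d null) ⟩
        d zero    ≡⟨ outside zero e₂∉S ⟩
        0ℚ        ∎
    dependent-restrict {b ∷ S} (d , outside , nonzero , null) (suc g , suc-g∉) =
      S , (g , drop-not-there suc-g∉) ,
      d ∘ suc , (λ f f∉ → outside (suc f) (f∉ ∘ drop-there)) ,
      nonzero-restrict d null nonzero , null-restrict d null

mainTheorem10 : ∀ {n m} (G : OHG n m) (e : Fin m)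
    (part : Fin (length (inc G)) → Bool) (s₁ s₂ : Sign) →
    Compatible s₁ s₂ →
    MinimallyDependent G →
    MinimallyDependent (subdivide G e part s₁ s₂)
mainTheorem10 G e part s₁ s₂ compatible (dependent , minimal) =
  dependent-split compatible dependent , minimal′
  where
  open Subdivision G e part s₁ s₂
  minimal′ : ∀ S → ∃[ f ] f ∉ S → ¬ DependentOn G′ S
  minimal′ S missing dependentOnS =
    let T , missingT , dependentOnT = dependent-restrict compatible dependentOnS missing
    in minimal T missingT dependentOnT
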